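{- For the cycle $C_n$ of length $n \ge 3$, $\mathrm{Maj}_g(C_n) = 3$ if $n \neq 4$, and $\mathrm{Maj}_g(C_n) = 2$ if $n = 4$.
   Context: Strong majority coloring game: given a graph $G$ and a palette of $k$ colors, two players Alice and Bob alternately (Alice first) choose an uncolored vertex of $G$ and assign it a color from the palette, so that after every move the strong majority condition holds: for every vertex $v$ (colored or uncolored) and every color $c$, at most $\deg(v)/2$ of the neighbors of $v$ have color $c$. Alice wins if all vertices get colored; Bob wins if at some point there is an uncolored vertex to which no color of the palette can be legally assigned. The strong majority game chromatic number $\mathrm{Maj}_g(G)$ is the least $k$ such that Alice has a winning strategy with a palette of $k$ colors. -}

module Defs where

open import Data.Fin using (Fin; toℕ)
import Data.Fin.Properties as Fin
open import Data.List using (allFin; filter; length)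
open import Data.Maybe using (Maybe; just; nothing)
import Data.Maybe.Properties as Maybe
open import Data.Nat using (ℕ; suc; _*_; _≤_; s≤s; _≟_)
open import Data.Nat.Properties using (1+n≢n)
open import Data.Product using (_×_; _,_; ∃-syntax)
open import Data.Sum using (_⊎_; inj₁; inj₂; swap)
open import Data.Vec using (Vec; lookup; replicate; _[_]≔_)
open import Relation.Binary.Definitions using (Decidable; Symmetric)
open import Relation.Binary.PropositionalEquality using (_≡_; sym; trans; cong; subst)
open import Relation.Nullary using (¬_; Dec)
open import Relation.Nullary.Decidable using (_×-dec_; _⊎-dec_)

record Graph (n : ℕ) : Set₁ where
  field
    _~_      : Fin n → Fin n → Set
    _~?_     : Decidable _~_
    ~-sym    : Symmetric _~_
    ~-irrefl : ∀ {v} → ¬ (v ~ v)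

  deg : Fin n → ℕ
  deg v = length (filter (v ~?_) (allFin n))

Colouring : ℕ → ℕ → Set
Colouring n k = Vec (Maybe (Fin k)) n

data Player : Set where
  alice bob : Player

module _ {n : ℕ} (G : Graph n) {k : ℕ} where
  open Graph G

  hasColour? : (f : Colouring n k) (c : Fin k) (u : Fin n) → Dec (lookup f u ≡ just c)
  hasColour? f c u = Maybe.≡-dec Fin._≟_ (lookup f u) (just c)

  colourDeg : Colouring n k → Fin n → Fin k → ℕ
  colourDeg f v c =
    length (filter (λ u → (v ~? u) ×-dec hasColour? f c u) (allFin n))

  -- Required of all vertices v, uncoloured ones included.
  StrongMajority : Colouring n k → Set
  StrongMajority f = ∀ v c → 2 * colourDeg f v c ≤ deg v

  Uncoloured : Colouring n k → Fin n → Set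
  Uncoloured f v = lookup f v ≡ nothing

  colour : Colouring n k → Fin n → Fin k → Colouring n k
  colour f v c = f [ v ]≔ just c

  LegalMove : Colouring n k → Fin n → Fin k → Set
  LegalMove f v c = Uncoloured f v × StrongMajority (colour f v c)

  Complete : Colouring n k → Set
  Complete f = ∀ v → ¬ Uncoloured f v

  BobHasWon : Colouring n k → Set
  BobHasWon f = ∃[ v ] (Uncoloured f v × (∀ c → ¬ LegalMove f v c))

  -- AliceWins p f: Alice has a winning strategy from position f with player p
  -- to move; an inhabitant is a strategy tree.  The inductive reading is the
  -- right one because every play has at most n moves.
  data AliceWins : Player → Colouring n k → Set where
    complete  : ∀ {p f} → Complete f → AliceWins p f
    aliceMove : ∀ {f} → ¬ BobHasWon f →
                ∀ v c → LegalMove f v c → AliceWins bob (colour f v c) →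
                AliceWins alice f
    bobMove   : ∀ {f} → ¬ BobHasWon f →
                (∀ v c → LegalMove f v c → AliceWins alice (colour f v c)) →
                AliceWins bob f

AliceWinsWith : ∀ {n} → Graph n → ℕ → Set
AliceWinsWith {n} G k = AliceWins G {k} alice (replicate n nothing)

-- Maj_g(G) = k.  A relation rather than a function, since for some graphs
-- (e.g. those with a leaf) no number of colours lets Alice win.
IsMajg : ∀ {n} → Graph n → ℕ → Set
IsMajg G k = AliceWinsWith G k × (∀ j → AliceWinsWith G j → k ≤ j)

-- v is the cyclic successor of u in 0, 1, …, n-1.
Next : ∀ {n} → Fin n → Fin n → Set
Next {n} u v = (toℕ v ≡ suc (toℕ u)) ⊎ (suc (toℕ u) ≡ n × toℕ v ≡ 0)

next? : ∀ {n} → Decidable (Next {n})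
next? {n} u v = (toℕ v ≟ suc (toℕ u)) ⊎-dec ((suc (toℕ u) ≟ n) ×-dec (toℕ v ≟ 0))

next-irrefl : ∀ {n} → 3 ≤ n → {v : Fin n} → ¬ Next v v
next-irrefl _ (inj₁ e) = 1+n≢n (sym e)
next-irrefl 3≤n {v} (inj₂ (e , z)) with subst (3 ≤_) (trans (sym e) (cong suc z)) 3≤n
... | s≤s ()

cycle : (n : ℕ) → 3 ≤ n → Graph n
cycle n 3≤n = record
  { _~_      = λ u v → Next u v ⊎ Next v u
  ; _~?_     = λ u v → next? u v ⊎-dec next? v u
  ; ~-sym    = swap
  ; ~-irrefl = λ { (inj₁ e) → next-irrefl 3≤n e ; (inj₂ e) → next-irrefl 3≤n e }
  }

{-# OPTIONS --safe #-}

-- On a cycle every degree is 2, so the strong majority condition says exactly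
-- that vertices two steps apart never share a colour.  Each vertex has at most
-- two vertices two steps away (only one if n = 4), so with three (respectively
-- two) colours no vertex ever gets stuck and Alice wins by playing anything.
-- With two colours and n ≠ 4, Bob answers Alice's first move at v by giving the
-- other colour to v + 4, after which v + 2 can no longer be coloured.
module Submission where

open import Defs
open import Data.Fin using (Fin; zero; suc; toℕ; fromℕ; fromℕ<; inject₁)
import Data.Fin.Properties as Fin
open import Data.List using (List; []; _∷_; length; filter; allFin; lookup)
open import Data.List.Membership.Propositional using (_∈_)
open import Data.List.Membership.Propositional.Properties using (∈-lookup; ∈-filter⁺; ∈-filter⁻; ∈-allFin)
open import Data.List.Membership.Setoid.Properties using (index-injective)
open import Data.List.Relation.Binary.Subset.Propositional using (_⊆_)
import Data.List.Relation.Unary.All as All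
open import Data.List.Relation.Unary.Any using (here; there; index)
open import Data.List.Relation.Unary.AllPairs using ([]; _∷_)
open import Data.List.Relation.Unary.Unique.Propositional using (Unique)
open import Data.List.Relation.Unary.Unique.Propositional.Properties using (filter⁺; allFin⁺)
open import Data.Maybe using (Maybe; just; nothing)
import Data.Maybe.Properties as Maybe
open import Data.Nat using (ℕ; zero; suc; _+_; _*_; _≤_; _<_; z≤n; s≤s; _≟_)
open import Data.Nat.Properties
open import Data.Product using (_×_; _,_; proj₁; proj₂; ∃-syntax)
open import Data.Sum using (_⊎_; inj₁; inj₂)
open import Data.Vec as Vec using ([]; _∷_; replicate)
open import Data.Vec.Properties using (lookup∘update; lookup∘update′; lookup-replicate)
open import Function using (_∘_)
open import Relation.Binary.PropositionalEquality using (_≡_; _≢_; refl; sym; trans; cong; subst; setoid; module ≡-Reasoning)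
open import Relation.Nullary using (¬_; yes; no; contradiction)
open import Relation.Unary using (Decidable)

-- Counting in lists without repetition.

module _ {a} {A : Set a} where

  lookup-injective : {xs : List A} → Unique xs → ∀ {i j} → lookup xs i ≡ lookup xs j → i ≡ j
  lookup-injective (_  ∷ _)   {zero}  {zero}  _  = refl
  lookup-injective (x∉ ∷ _)   {zero}  {suc j} eq = contradiction eq (All.lookup x∉ (∈-lookup j))
  lookup-injective (x∉ ∷ _)   {suc i} {zero}  eq = contradiction (sym eq) (All.lookup x∉ (∈-lookup i))
  lookup-injective (_  ∷ xs!) {suc i} {suc j} eq = cong suc (lookup-injective xs! eq)

  -- Sending each position of `xs` to a position of the same element in `ys` is injective, because
  -- equal target positions hold equal elements and `xs` repeats none.
  Unique-⊆⇒length≤ : {xs ys : List A} → Unique xs → xs ⊆ ys → length xs ≤ length ys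
  Unique-⊆⇒length≤ xs! xs⊆ys = Fin.injective⇒≤ λ {i} {j} eq →
    lookup-injective xs!
      (index-injective (setoid A) (xs⊆ys (∈-lookup i)) (xs⊆ys (∈-lookup j)) eq)

module _ {n p} {P : Fin n → Set p} (P? : Decidable P) where

  length-filter-allFin-≤ : ∀ ys → (∀ {u} → P u → u ∈ ys) → length (filter P? (allFin n)) ≤ length ys
  length-filter-allFin-≤ ys P⇒∈ =
    Unique-⊆⇒length≤ (filter⁺ P? (allFin⁺ n)) (P⇒∈ ∘ proj₂ ∘ ∈-filter⁻ P? {xs = allFin n})

  length-filter-allFin-≥2 : ∀ {u v} → u ≢ v → P u → P v → 2 ≤ length (filter P? (allFin n))
  length-filter-allFin-≥2 u≢v Pu Pv = Unique-⊆⇒length≤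
    ((u≢v All.∷ All.[]) ∷ All.[] ∷ [])
    λ { (here refl)         → ∈-filter⁺ P? (∈-allFin _) Pu
      ; (there (here refl)) → ∈-filter⁺ P? (∈-allFin _) Pv }

-- Won and lost positions of the game on an arbitrary graph.

blanks : ∀ {n k} → Colouring n k → ℕ
blanks []            = 0
blanks (nothing ∷ f) = suc (blanks f)
blanks (just _  ∷ f) = blanks f

blanks-update : ∀ {n k} (f : Colouring n k) v c → Vec.lookup f v ≡ nothing →
                blanks f ≡ suc (blanks (f Vec.[ v ]≔ just c))
blanks-update (nothing ∷ f) zero    c _  = refl
blanks-update (nothing ∷ f) (suc v) c eq = cong suc (blanks-update f v c eq)
blanks-update (just _  ∷ f) (suc v) c eq = blanks-update f v c eq

module _ {n : ℕ} (G : Graph n) {k : ℕ}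
         (extend : ∀ (f : Colouring n k) v → StrongMajority G f → Uncoloured G f v →
                   ∃[ c ] StrongMajority G (colour G f v c))
         where

  never-stuck : (f : Colouring n k) → StrongMajority G f → ¬ BobHasWon G f
  never-stuck f sm (v , v∘ , stuck) with extend f v sm v∘
  ... | c , sm′ = stuck c (v∘ , sm′)

  -- Induction on the number `m` of uncoloured vertices, which drops by one with each move. A legal
  -- move keeps the strong majority condition, so `extend` applies again whatever Bob plays, and
  -- Alice may take any colour it offers.
  extendable⇒aliceWins : ∀ m p (f : Colouring n k) → blanks f ≡ m → StrongMajority G f → AliceWins G p f
  extendable⇒aliceWins m p f eq sm with Fin.any? (λ v → Maybe.≡-dec Fin._≟_ (Vec.lookup f v) nothing)
  ... | no  full     = complete λ v v∘ → full (v , v∘)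
  -- An uncoloured vertex makes `blanks f` positive; the colour from `extend` serves only to
  -- instantiate `blanks-update`.
  extendable⇒aliceWins zero p f eq sm | yes (v , v∘) with extend f v sm v∘
  ... | c , _ = contradiction (trans (sym (blanks-update f v c v∘)) eq) λ ()
  extendable⇒aliceWins (suc m) alice f eq sm | yes (v , v∘) with extend f v sm v∘
  ... | c , sm′ = aliceMove (never-stuck f sm) v c (v∘ , sm′)
    (extendable⇒aliceWins m bob _ (suc-injective (trans (sym (blanks-update f v c v∘)) eq)) sm′)
  extendable⇒aliceWins (suc m) bob f eq sm | yes _ = bobMove (never-stuck f sm) λ v c (v∘ , sm′) →
    extendable⇒aliceWins m alice _ (suc-injective (trans (sym (blanks-update f v c v∘)) eq)) sm′

BobHasWon⇒¬AliceWins : ∀ {n} (G : Graph n) {k p} {f : Colouring n k} → BobHasWon G f → ¬ AliceWins G p f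
BobHasWon⇒¬AliceWins G (v , v∘ , _) (complete full)    = full v v∘
BobHasWon⇒¬AliceWins G won          (aliceMove ¬w _ _ _ _) = ¬w won
BobHasWon⇒¬AliceWins G won          (bobMove ¬w _)     = ¬w won

-- Walks along the cyclic order and their lengths modulo `n`.

module _ {n : ℕ} where

  Next-functional : {u v w : Fin n} → Next u v → Next u w → v ≡ w
  Next-functional (inj₁ p)       (inj₁ q)       = Fin.toℕ-injective (trans p (sym q))
  Next-functional {v = v} (inj₁ p) (inj₂ (e , _)) = contradiction (trans p e) (<⇒≢ (Fin.toℕ<n v))
  Next-functional {w = w} (inj₂ (e , _)) (inj₁ q) = contradiction (trans q e) (<⇒≢ (Fin.toℕ<n w))
  Next-functional (inj₂ (_ , p)) (inj₂ (_ , q)) = Fin.toℕ-injective (trans p (sym q))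

  Next-injective : {u v w : Fin n} → Next u w → Next v w → u ≡ v
  Next-injective (inj₁ p)       (inj₁ q)       = Fin.toℕ-injective (suc-injective (trans (sym p) q))
  Next-injective (inj₁ p)       (inj₂ (_ , z)) = contradiction (trans (sym z) p) 0≢1+n
  Next-injective (inj₂ (_ , z)) (inj₁ q)       = contradiction (trans (sym z) q) 0≢1+n
  Next-injective (inj₂ (p , _)) (inj₂ (q , _)) = Fin.toℕ-injective (suc-injective (trans p (sym q)))

  -- The witness `b` counts the passages from `n - 1` to 0. Keeping it explicit makes congruences
  -- compose by adding quotients.
  Next-modulo : {u v : Fin n} → Next u v → ∃[ b ] toℕ v + b * n ≡ suc (toℕ u)
  Next-modulo (inj₁ p)       = 0 , trans (+-identityʳ _) p
  Next-modulo {u} {v} (inj₂ (e , z)) = 1 , (begin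
    toℕ v + 1 * n ≡⟨ cong (_+ 1 * n) z ⟩
    1 * n         ≡⟨ *-identityˡ n ⟩
    n             ≡⟨ e ⟨
    suc (toℕ u)   ∎)
    where open ≡-Reasoning

  modulo-trans : ∀ {u v w : Fin n} {i j} →
                 ∃[ b ] toℕ v + b * n ≡ i + toℕ u → ∃[ b ] toℕ w + b * n ≡ j + toℕ v →
                 ∃[ b ] toℕ w + b * n ≡ j + i + toℕ u
  modulo-trans {u} {v} {w} {i} {j} (b , p) (b′ , q) = b′ + b , (begin
    toℕ w + (b′ + b) * n     ≡⟨ cong (toℕ w +_) (*-distribʳ-+ n b′ b) ⟩
    toℕ w + (b′ * n + b * n) ≡⟨ +-assoc (toℕ w) _ _ ⟨
    toℕ w + b′ * n + b * n   ≡⟨ cong (_+ b * n) q ⟩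
    j + toℕ v + b * n        ≡⟨ +-assoc j _ _ ⟩
    j + (toℕ v + b * n)      ≡⟨ cong (j +_) p ⟩
    j + (i + toℕ u)          ≡⟨ +-assoc j i _ ⟨
    j + i + toℕ u            ∎)
    where open ≡-Reasoning

  -- The length of a closed walk is a multiple of `n`; this is what excludes closed walks of length
  -- 2 and, for `n ≢ 4`, of length 4.
  modulo-refl : ∀ {u : Fin n} {i} → ∃[ b ] toℕ u + b * n ≡ i + toℕ u → ∃[ b ] b * n ≡ i
  modulo-refl {u} {i} (b , p) = b , +-cancelˡ-≡ (toℕ u) _ _ (trans p (+-comm i _))

  TwoSteps : Fin n → Fin n → Set
  TwoSteps u w = ∃[ v ] (Next u v × Next v w)

  TwoSteps-functional : {u v w : Fin n} → TwoSteps u v → TwoSteps u w → v ≡ w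
  TwoSteps-functional (_ , p , q) (_ , p′ , q′) with refl ← Next-functional p p′ = Next-functional q q′

  TwoSteps-injective : {u v w : Fin n} → TwoSteps u w → TwoSteps v w → u ≡ v
  TwoSteps-injective (_ , p , q) (_ , p′ , q′) with refl ← Next-injective q q′ = Next-injective p p′

  TwoSteps-modulo : {u v : Fin n} → TwoSteps u v → ∃[ b ] toℕ v + b * n ≡ 2 + toℕ u
  TwoSteps-modulo (_ , p , q) = modulo-trans {i = 1} {j = 1} (Next-modulo p) (Next-modulo q)

  FourSteps-modulo : {u v w : Fin n} → TwoSteps u v → TwoSteps v w → ∃[ b ] toℕ w + b * n ≡ 4 + toℕ u
  FourSteps-modulo p q = modulo-trans {i = 2} {j = 2} (TwoSteps-modulo p) (TwoSteps-modulo q)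

  TwoSteps-irrefl : 3 ≤ n → {u : Fin n} → ¬ TwoSteps u u
  TwoSteps-irrefl 3≤n p with modulo-refl {i = 2} (TwoSteps-modulo p)
  ... | suc b , e = <⇒≱ 3≤n (subst (n ≤_) e (m≤m+n n (b * n)))

  FourSteps-irrefl : 3 ≤ n → n ≢ 4 → {u v : Fin n} → TwoSteps u v → ¬ TwoSteps v u
  FourSteps-irrefl 3≤n n≢4 p q with modulo-refl {i = 4} (FourSteps-modulo p q)
  ... | 1           , e = n≢4 (trans (sym (*-identityˡ n)) e)
  -- Here `n` would be counted at least twice, giving a length of at least 2 * 3 = 6 instead of 4.
  ... | suc (suc b) , e = contradiction
    (≤-trans (*-mono-≤ {2} {2 + b} (s≤s (s≤s z≤n)) 3≤n) (≤-reflexive e))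
    λ { (s≤s (s≤s (s≤s (s≤s ())))) }

-- In `toℕ w + b * 4 ≡ 4 + toℕ u` both vertices are below 4. So `b` = 0 makes the left side too
-- small, `b` at least 2 makes it too large, and `b` = 1 leaves `w ≡ u`.
FourSteps-closed : {u v w : Fin 4} → TwoSteps u v → TwoSteps v w → w ≡ u
FourSteps-closed {u} {v} {w} p q with FourSteps-modulo p q
... | 0 , e = contradiction (Fin.toℕ<n w)
  (≤⇒≯ (≤-trans (m≤m+n 4 (toℕ u)) (≤-reflexive (trans (sym e) (+-identityʳ _)))))
... | 1 , e = Fin.toℕ-injective (+-cancelʳ-≡ 4 _ _ (trans e (+-comm 4 _)))
... | suc (suc b) , e = contradiction (+-monoʳ-< 4 (Fin.toℕ<n u))
  (≤⇒≯ (≤-trans (≤-trans (m≤m+n 8 (b * 4)) (m≤n+m _ (toℕ w))) (≤-reflexive e)))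

prev : ∀ {n} (v : Fin n) → ∃[ u ] Next u v
prev {suc m} zero    = fromℕ m , inj₂ (cong suc (Fin.toℕ-fromℕ m) , refl)
prev {suc m} (suc i) = inject₁ i , inj₁ (cong suc (sym (Fin.toℕ-inject₁ i)))

-- Choosing colours from palettes of size three and two.

avoidTwo : (x y : Maybe (Fin 3)) → ∃[ c ] (x ≢ just c × y ≢ just c)
avoidTwo x y with twoAvoiding x
  where
  twoAvoiding : (x : Maybe (Fin 3)) → ∃[ a ] ∃[ b ] (a ≢ b × x ≢ just a × x ≢ just b)
  twoAvoiding nothing                 = zero , suc zero , (λ ()) , (λ ()) , λ ()
  twoAvoiding (just zero)             = suc zero , suc (suc zero) , (λ ()) , (λ ()) , λ ()
  twoAvoiding (just (suc zero))       = zero , suc (suc zero) , (λ ()) , (λ ()) , λ ()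
  twoAvoiding (just (suc (suc zero))) = zero , suc zero , (λ ()) , (λ ()) , λ ()
-- Of two distinct colours that avoid `x`, at most one can be excluded by `y`.
... | a , b , a≢b , x≢a , x≢b with Maybe.≡-dec Fin._≟_ y (just a)
...   | no  y≢a = a , x≢a , y≢a
...   | yes y≡a = b , x≢b , λ y≡b → a≢b (Maybe.just-injective (trans (sym y≡a) y≡b))

other : Fin 2 → Fin 2
other zero       = suc zero
other (suc zero) = zero

other-≢ : ∀ c → c ≢ other c
other-≢ zero       ()
other-≢ (suc zero) ()

either : ∀ c d → d ≡ c ⊎ d ≡ other c
either zero       zero       = inj₁ refl
either zero       (suc zero) = inj₂ refl
either (suc zero) zero       = inj₂ refl
either (suc zero) (suc zero) = inj₁ refl

-- Strong majority on a cycle as properness at distance two.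

module Cycle (n : ℕ) (3≤n : 3 ≤ n) where

  private
    C : Graph n
    C = cycle n 3≤n

    0<n : 0 < n
    0<n = ≤-trans (s≤s z≤n) 3≤n

  next : (u : Fin n) → ∃[ v ] Next u v
  next u with suc (toℕ u) ≟ n
  ... | yes e  = fromℕ< 0<n , inj₂ (e , Fin.toℕ-fromℕ< 0<n)
  ... | no 1+u≢n = fromℕ< 1+u<n , inj₁ (Fin.toℕ-fromℕ< 1+u<n)
    where 1+u<n = ≤∧≢⇒< (Fin.toℕ<n u) 1+u≢n

  twoAhead : (u : Fin n) → ∃[ w ] TwoSteps u w
  twoAhead u with next u
  ... | v , p with next v
  ...   | w , q = w , v , p , q

  twoBehind : (w : Fin n) → ∃[ u ] TwoSteps u w
  twoBehind w with prev w
  ... | v , q with prev v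
  ...   | u , p = u , v , p , q

  TwoSteps⇒≢ : {u v : Fin n} → TwoSteps u v → u ≢ v
  TwoSteps⇒≢ p refl = TwoSteps-irrefl 3≤n p

  2≤deg : ∀ v → 2 ≤ Graph.deg C v
  2≤deg v with prev v | next v
  ... | u , p | w , q = length-filter-allFin-≥2 (Graph._~?_ C v) (TwoSteps⇒≢ (v , p , q)) (inj₂ p) (inj₁ q)

  deg≤2 : ∀ v → Graph.deg C v ≤ 2
  deg≤2 v with prev v | next v
  ... | u , p | w , q = length-filter-allFin-≤ (Graph._~?_ C v) (u ∷ w ∷ [])
    λ { (inj₁ q′) → there (here (Next-functional q′ q)) ; (inj₂ p′) → here (Next-injective p′ p) }

  module _ {k : ℕ} where

    -- Partial proper colourings of the graph that joins vertices two steps apart; uncoloured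
    -- vertices impose nothing.
    Proper : Colouring n k → Set
    Proper f = ∀ {u w c} → TwoSteps u w → Vec.lookup f u ≡ just c → Vec.lookup f w ≢ just c

    -- If both ends of a two-step walk had colour `c`, the middle vertex would have two neighbours
    -- of that colour, and the condition there would read 4 ≤ 2.
    StrongMajority⇒Proper : ∀ f → StrongMajority C f → Proper f
    StrongMajority⇒Proper f sm {c = c} t@(v , p , q) fu fw = contradiction
      (≤-trans (*-monoʳ-≤ 2 2≤colourDeg) (≤-trans (sm v c) (deg≤2 v)))
      λ { (s≤s (s≤s ())) }
      where
      2≤colourDeg : 2 ≤ colourDeg C f v c
      2≤colourDeg = length-filter-allFin-≥2 _ (TwoSteps⇒≢ t) (inj₂ p , fu) (inj₁ q , fw)

    Proper⇒StrongMajority : ∀ f → Proper f → StrongMajority C f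
    Proper⇒StrongMajority f proper v c = ≤-trans (*-monoʳ-≤ 2 colourDeg≤1) (2≤deg v)
      where
      colourDeg≤1 : colourDeg C f v c ≤ 1
      colourDeg≤1 with prev v
      -- Only the predecessor `u` and the successor of `v` can count. If `u` has colour `c`,
      -- properness bars the successor; otherwise only the successor remains.
      ... | u , p with hasColour? C f c u
      ...   | yes fu = length-filter-allFin-≤ _ (u ∷ [])
        λ { (inj₁ q , fw)  → contradiction fw (proper (v , p , q) fu)
          ; (inj₂ p′ , _) → here (Next-injective p′ p) }
      ...   | no ¬fu = length-filter-allFin-≤ _ (proj₁ (next v) ∷ [])
        λ { (inj₁ q , _)   → here (Next-functional q (proj₂ (next v)))
          ; (inj₂ p′ , fu) → contradiction (subst (λ x → Vec.lookup f x ≡ just c) (Next-injective p′ p) fu) ¬fu }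

    empty : Colouring n k
    empty = replicate n nothing

    empty-Proper : Proper empty
    empty-Proper {u} _ fu with () ← trans (sym (lookup-replicate u nothing)) fu

    Free : Colouring n k → Fin n → Fin k → Set
    Free f v c = ∀ w → TwoSteps v w ⊎ TwoSteps w v → Vec.lookup f w ≢ just c

    -- Only pairs containing `v` are new, and in such a pair the other vertex is one of those that
    -- `Free` inspects. It differs from `v`, so the update left it unchanged.
    Free⇒Proper : ∀ f {v c} → Proper f → Free f v c → Proper (colour C f v c)
    Free⇒Proper f {v} {c} proper free {u} {w} {d} t fu fw with u Fin.≟ v | w Fin.≟ v
    ... | yes refl | yes refl = TwoSteps-irrefl 3≤n t
    ... | yes refl | no  w≢v  = free w (inj₁ t)
      (trans (sym (lookup∘update′ w≢v f _)) (trans fw (trans (sym fu) (lookup∘update v f _))))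
    ... | no  u≢v  | yes refl = free u (inj₂ t)
      (trans (sym (lookup∘update′ u≢v f _)) (trans fu (trans (sym fw) (lookup∘update v f _))))
    ... | no  u≢v  | no  w≢v  = proper t
      (trans (sym (lookup∘update′ u≢v f _)) fu) (trans (sym (lookup∘update′ w≢v f _)) fw)

    free⇒aliceWins : (∀ f v → ∃[ c ] Free f v c) → AliceWinsWith C k
    free⇒aliceWins free = extendable⇒aliceWins C extend _ alice empty refl
                            (Proper⇒StrongMajority empty empty-Proper)
      where
      extend : ∀ f v → StrongMajority C f → Uncoloured C f v → ∃[ c ] StrongMajority C (colour C f v c)
      extend f v sm _ with free f v
      ... | c , fr = c , Proper⇒StrongMajority (colour C f v c) (Free⇒Proper f (StrongMajority⇒Proper f sm) fr)

    colour-clash⇒illegal : ∀ f {v w c} → TwoSteps v w ⊎ TwoSteps w v → Vec.lookup f w ≡ just c → ¬ LegalMove C f v c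
    colour-clash⇒illegal f {v} (inj₁ t) fw (_ , sm) = StrongMajority⇒Proper (colour C f v _) sm t
      (lookup∘update v f _) (trans (lookup∘update′ (TwoSteps⇒≢ t ∘ sym) f _) fw)
    colour-clash⇒illegal f {v} (inj₂ t) fw (_ , sm) = StrongMajority⇒Proper (colour C f v _) sm t
      (trans (lookup∘update′ (TwoSteps⇒≢ t) f _) fw) (lookup∘update v f _)

  -- Three colours suffice on every cycle.

  aliceWins-3 : AliceWinsWith C 3
  aliceWins-3 = free⇒aliceWins free
    where
    free : ∀ f v → ∃[ c ] Free f v c
    free f v with twoAhead v | twoBehind v
    ... | w , t | u , s with avoidTwo (Vec.lookup f w) (Vec.lookup f u)
    ...   | c , fw , fu = c , λ
      -- A vertex two steps from `v` in either direction is unique, hence equal to `w` or `u`, whose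
      -- colours `c` avoids.
      { x (inj₁ t′) → subst (λ y → Vec.lookup f y ≢ just c) (TwoSteps-functional t t′) fw
      ; x (inj₂ s′) → subst (λ y → Vec.lookup f y ≢ just c) (TwoSteps-injective s s′) fu }

  -- Too few colours.

  v₀ : Fin n
  v₀ = fromℕ< 0<n

  ¬aliceWins-0 : ¬ AliceWinsWith C 0
  ¬aliceWins-0 = BobHasWon⇒¬AliceWins C (v₀ , lookup-replicate v₀ nothing , λ ())

  module _ {k : ℕ} (v : Fin n) (c : Fin k) where

    afterAlice : Colouring n k
    afterAlice = colour C empty v c

    afterAlice-uncoloured : ∀ {u} → u ≢ v → Uncoloured C afterAlice u
    afterAlice-uncoloured {u} u≢v = trans (lookup∘update′ u≢v empty _) (lookup-replicate u nothing)

  -- Alice's own first move at `v` puts the only colour two steps from `m`, so `m` is stuck before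
  -- Bob replies.
  ¬aliceWins-1 : ¬ AliceWinsWith C 1
  ¬aliceWins-1 (complete full) = full v₀ (lookup-replicate v₀ nothing)
  ¬aliceWins-1 (aliceMove _ v zero _ w) with twoAhead v
  ... | m , t = BobHasWon⇒¬AliceWins C {f = f}
      (m , afterAlice-uncoloured v zero (TwoSteps⇒≢ t ∘ sym) ,
       λ { zero → colour-clash⇒illegal f (inj₂ t) (lookup∘update v empty _) }) w
    where
    f : Colouring n 1
    f = afterAlice v zero

  ¬aliceWins-2 : n ≢ 4 → ¬ AliceWinsWith C 2
  ¬aliceWins-2 n≢4 (complete full) = full v₀ (lookup-replicate v₀ nothing)
  ¬aliceWins-2 n≢4 (aliceMove _ v c (_ , sm) wins) with twoAhead v
  ... | m , t with twoAhead m
  ...   | w , s = refute wins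
    where
    -- This is where `n ≢ 4` enters: on the 4-cycle `w` would be `v`, which Alice has just coloured.
    v≢w : v ≢ w
    v≢w refl = FourSteps-irrefl 3≤n n≢4 t s

    f : Colouring n 2
    f = afterAlice v c

    g : Colouring n 2
    g = colour C f w (other c)

    -- So far only `v` is coloured, and with `c`. Bob's choice of the other colour is therefore safe
    -- even when `v` lies two steps beyond `w`, as for `n` = 3 and `n` = 6.
    w-free : Free f w (other c)
    w-free u _ fu with u Fin.≟ v
    ... | yes refl = other-≢ c (Maybe.just-injective (trans (sym (lookup∘update v empty _)) fu))
    ... | no  u≢v with () ← trans (sym (afterAlice-uncoloured v c u≢v)) fu

    reply-legal : LegalMove C f w (other c)
    reply-legal = afterAlice-uncoloured v c (v≢w ∘ sym) ,
                  Proper⇒StrongMajority g (Free⇒Proper f (StrongMajority⇒Proper f sm) w-free)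

    gv : Vec.lookup g v ≡ just c
    gv = trans (lookup∘update′ v≢w f _) (lookup∘update v empty _)

    stuck : ∀ d → ¬ LegalMove C g m d
    stuck d with either c d
    -- Two steps behind `m`, vertex `v` blocks `c`; two steps ahead, `w` blocks `other c`.
    ... | inj₁ refl = colour-clash⇒illegal g (inj₂ t) gv
    ... | inj₂ refl = colour-clash⇒illegal g (inj₁ s) (lookup∘update w f _)

    bobHasWon : BobHasWon C g
    bobHasWon = m , trans (lookup∘update′ (TwoSteps⇒≢ s) f _) (afterAlice-uncoloured v c (TwoSteps⇒≢ t ∘ sym)) , stuck

    refute : ¬ AliceWins C bob f
    refute (complete full)  = full m (afterAlice-uncoloured v c (TwoSteps⇒≢ t ∘ sym))
    refute (bobMove _ wins) = BobHasWon⇒¬AliceWins C bobHasWon (wins w (other c) reply-legal)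

-- Two colours suffice on the 4-cycle.

aliceWins-C₄ : (3≤4 : 3 ≤ 4) → AliceWinsWith (cycle 4 3≤4) 2
aliceWins-C₄ 3≤4 = free⇒aliceWins free
  where
  open Cycle 4 3≤4

  avoid : (x : Maybe (Fin 2)) → ∃[ c ] x ≢ just c
  avoid nothing  = zero , λ ()
  avoid (just a) = other a , other-≢ a ∘ Maybe.just-injective

  free : ∀ f v → ∃[ c ] Free f v c
  free f v with twoAhead v
  ... | w , t with avoid (Vec.lookup f w)
  ...   | c , fw = c , λ
    { x (inj₁ t′) → subst (λ y → Vec.lookup f y ≢ just c) (TwoSteps-functional t t′) fw
    -- The vertices two ahead of and two behind `v` coincide, so avoiding the colour of `w` meets
    -- both constraints.
    ; x (inj₂ s)  → subst (λ y → Vec.lookup f y ≢ just c) (FourSteps-closed s t) fw }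

theorem10 : (n : ℕ) (3≤n : 3 ≤ n) →
    (n ≢ 4 → IsMajg (cycle n 3≤n) 3) × (n ≡ 4 → IsMajg (cycle n 3≤n) 2)
theorem10 n 3≤n = (λ n≢4 → aliceWins-3 , λ j → 3≤colours n≢4 {j}) ,
                  (λ { refl → aliceWins-C₄ 3≤n , λ j → 2≤colours {j} })
  where
  open Cycle n 3≤n

  2≤colours : ∀ {j} → AliceWinsWith (cycle n 3≤n) j → 2 ≤ j
  2≤colours {0}           w = contradiction w ¬aliceWins-0
  2≤colours {1}           w = contradiction w ¬aliceWins-1
  2≤colours {suc (suc j)} w = s≤s (s≤s z≤n)

  3≤colours : n ≢ 4 → ∀ {j} → AliceWinsWith (cycle n 3≤n) j → 3 ≤ j
  3≤colours n≢4 {j} w = ≤∧≢⇒< (2≤colours w) λ { refl → ¬aliceWins-2 n≢4 w }
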